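{- Let $A$ be a strongly computable finite factorization domain and let $F$ be its field of fractions. There is a computable procedure which, given an arbitrary pair of elements $a,b \in A$ with $b \neq 0$, finds a pair $c,d \in A$ with $d \neq 0$, $\frac{c}{d} = \frac{a}{b}$ in $F$, and such that the only common divisors of $c$ and $d$ in $A$ are the units of $A$.
   Context: A computable ring is a ring whose underlying set is a computable set $A \subseteq \mathbb{N}$ with addition and multiplication computable functions $A\times A \to A$. A strongly computable finite factorization domain (SCFFD) is a computable integral domain $A$ equipped with a computable function $D$ such that for every nonzero $a \in A$, $D(a)$ is a canonical index for the finite set of all divisors of $a$ in $A$. -}

module Defs where

open import Data.Nat using (ℕ)
open import Data.Bool using (Bool; T)
open import Data.Product using (Σ; ∃; _×_; _,_; proj₁; proj₂)
open import Data.Sum using (_⊎_)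
open import Data.List using (List)
open import Data.List.Membership.Propositional using (_∈_)
open import Relation.Binary.PropositionalEquality using (_≡_; _≢_)
open import Algebra.Structures using (IsCommutativeRing)
open import Level using (0ℓ)

-- A computable ring: the underlying set is a decidable (computable) subset
-- of ℕ, given by its characteristic function inA; the operations are Agda
-- functions (hence computable).  Equality is equality of the underlying
-- natural numbers (propositional equality on the subset type).
-- A strongly computable finite factorization domain additionally has
-- integral-domain axioms and a computable divisor function D listing all
-- divisors of each nonzero element (a finite list plays the role of the
-- canonical index of a finite set).
record SCFFD : Set₁ where
  field
    inA : ℕ → Bool

  Carrier : Set
  Carrier = Σ ℕ (λ n → T (inA n))

  field
    _+_ _*_ : Carrier → Carrier → Carrier
    -_      : Carrier → Carrier
    0# 1#   : Carrier
    isCommutativeRing : IsCommutativeRing _≡_ _+_ _*_ -_ 0# 1#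
    1≢0          : 1# ≢ 0#
    noZeroDivisors : ∀ x y → x * y ≡ 0# → x ≡ 0# ⊎ y ≡ 0#

  _∣_ : Carrier → Carrier → Set
  x ∣ y = ∃ λ z → x * z ≡ y

  IsUnit : Carrier → Set
  IsUnit u = ∃ λ v → u * v ≡ 1#

  field
    D        : (a : Carrier) → a ≢ 0# → List Carrier
    D-sound  : ∀ a (a≢0 : a ≢ 0#) x → x ∈ D a a≢0 → x ∣ a
    D-complete : ∀ a (a≢0 : a ≢ 0#) x → x ∣ a → x ∈ D a a≢0

  -- c/d = a/b in the field of fractions F, for b, d nonzero
  -- (standard construction of F: (a,b) ~ (c,d) iff a·d = b·c).
  SameFraction : Carrier → Carrier → Carrier → Carrier → Set
  SameFraction c d a b = a * d ≡ b * c

-- Given a/b with b ≠ 0 we repeatedly cancel common non-unit divisors.  The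
-- divisor lists D make everything decidable: divisibility x ∣ y is decided
-- by searching D y, and whether c and d are coprime is decided by searching
-- D d for a common non-unit divisor.  If one exists, say c = e·c' and
-- d = e·d', then c'/d' still equals a/b (cancellation in a domain), d' still
-- divides b, and d' is a proper divisor of d.  The loop terminates because
-- the number of divisors of b that divide the current denominator strictly
-- decreases along proper divisors (a counting fact about filtered lists).
module Submission where

open import Defs
open import Level using (0ℓ)
open import Data.Product using (Σ; ∃; _×_; _,_; proj₁; proj₂)
open import Data.Sum using (_⊎_; inj₁; inj₂)
open import Data.Nat using (ℕ; _<_; _≤_; z≤n; s≤s)
open import Data.Nat.Properties using (m≤n⇒m≤1+n) renaming (_≟_ to _≟ℕ_)
open import Data.Nat.Induction using (<-wellFounded)
open import Induction.WellFounded using (Acc; acc)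
open import Data.Bool.Properties using (T-irrelevant)
open import Data.List using ([]; _∷_; filter; length)
open import Data.List.Relation.Unary.Any using (here; there; any?; satisfied)
open import Data.List.Membership.Propositional using (_∈_; lose)
open import Data.Empty using (⊥-elim)
open import Relation.Nullary using (Dec; yes; no; ¬_)
open import Relation.Nullary.Decidable using (_×-dec_; ¬?)
open import Relation.Unary using (Pred; Decidable)
open import Relation.Binary using (DecidableEquality)
open import Relation.Binary.PropositionalEquality
  using (_≡_; _≢_; refl; sym; trans; cong; module ≡-Reasoning)
import Data.Product.Properties as Product
open import Algebra.Bundles using (CommutativeRing)

module FilterCount {A : Set} {P Q : Pred A 0ℓ}
  (P? : Decidable P) (Q? : Decidable Q) (P⇒Q : ∀ x → P x → Q x) where

  filter-mono : ∀ xs → length (filter P? xs) ≤ length (filter Q? xs)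
  filter-mono [] = z≤n
  filter-mono (x ∷ xs) with P? x | Q? x
  ... | yes _ | yes _  = s≤s (filter-mono xs)
  ... | yes p | no ¬q  = ⊥-elim (¬q (P⇒Q x p))
  ... | no _  | yes _  = m≤n⇒m≤1+n (filter-mono xs)
  ... | no _  | no _   = filter-mono xs

  filter-strict : ∀ {y} xs → y ∈ xs → Q y → ¬ P y →
                  length (filter P? xs) < length (filter Q? xs)
  filter-strict (x ∷ xs) (here refl) qx ¬px with P? x | Q? x
  ... | yes px | _     = ⊥-elim (¬px px)
  ... | no _   | yes _ = s≤s (filter-mono xs)
  ... | no _   | no ¬q = ⊥-elim (¬q qx)
  filter-strict (x ∷ xs) (there y∈xs) qy ¬py with P? x | Q? x
  ... | yes _ | yes _  = s≤s (filter-strict xs y∈xs qy ¬py)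
  ... | yes p | no ¬q  = ⊥-elim (¬q (P⇒Q x p))
  ... | no _  | yes _  = m≤n⇒m≤1+n (filter-strict xs y∈xs qy ¬py)
  ... | no _  | no _   = filter-strict xs y∈xs qy ¬py

module Reduction (A : SCFFD) where
  open SCFFD A

  commutativeRing : CommutativeRing 0ℓ 0ℓ
  commutativeRing = record { isCommutativeRing = isCommutativeRing }

  open CommutativeRing commutativeRing
    using (_-_; *-assoc; *-comm; *-identityʳ; zeroʳ; *-commutativeSemigroup)
  open import Algebra.Properties.Ring (CommutativeRing.ring commutativeRing)
    using (x[y-z]≈xy-xz; x≈y⇒x∙y⁻¹≈ε; x∙y⁻¹≈ε⇒x≈y)
  open import Algebra.Properties.CommutativeSemigroup *-commutativeSemigroup
    using (x∙yz≈y∙xz)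
  open ≡-Reasoning

  -- Elements are natural numbers tagged with a proof of membership, and
  -- membership proofs are unique, so equality is decidable.
  _≟_ : DecidableEquality Carrier
  _≟_ = Product.≡-dec _≟ℕ_ (λ p q → yes (T-irrelevant p q))

  open import Data.List.Membership.DecPropositional _≟_ using (_∈?_)

  ∣-refl : ∀ x → x ∣ x
  ∣-refl x = 1# , *-identityʳ x

  ∣-trans : ∀ {x y z} → x ∣ y → y ∣ z → x ∣ z
  ∣-trans {x} (k , xk≡y) (l , yl≡z) =
    k * l , trans (sym (*-assoc x k l)) (trans (cong (_* l) xk≡y) yl≡z)

  -- Divisibility is decidable: every element divides 0, and the divisors
  -- of a nonzero element are exactly the members of its list D.
  _∣?_ : ∀ x y → Dec (x ∣ y)
  x ∣? y with y ≟ 0#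
  ... | yes y≡0 = yes (0# , trans (zeroʳ x) (sym y≡0))
  ... | no y≢0 with x ∈? D y y≢0
  ...   | yes x∈D = yes (D-sound y y≢0 x x∈D)
  ...   | no x∉D  = no (λ x∣y → x∉D (D-complete y y≢0 x x∣y))

  unit? : ∀ u → Dec (IsUnit u)
  unit? u = u ∣? 1#

  *-cancelˡ : ∀ x {y z} → x ≢ 0# → x * y ≡ x * z → y ≡ z
  *-cancelˡ x {y} {z} x≢0 xy≡xz with noZeroDivisors x (y - z) x[y-z]≡0
    where
    x[y-z]≡0 : x * (y - z) ≡ 0#
    x[y-z]≡0 = trans (x[y-z]≈xy-xz x y z) (x≈y⇒x∙y⁻¹≈ε xy≡xz)
  ... | inj₁ x≡0   = ⊥-elim (x≢0 x≡0)
  ... | inj₂ y-z≡0 = x∙y⁻¹≈ε⇒x≈y y z y-z≡0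

  factor-≢0 : ∀ e x {y} → e * x ≡ y → y ≢ 0# → x ≢ 0#
  factor-≢0 e x ex≡y y≢0 x≡0 = y≢0 (trans (sym ex≡y) (trans (cong (e *_) x≡0) (zeroʳ e)))

  sameFraction-cancel : ∀ {a b c d} e c' d' → e ≢ 0# → e * c' ≡ c → e * d' ≡ d →
                        SameFraction c d a b → SameFraction c' d' a b
  sameFraction-cancel {a} {b} {c} {d} e c' d' e≢0 ec'≡c ed'≡d ad≡bc =
    *-cancelˡ e e≢0 (begin
      e * (a * d')  ≡⟨ x∙yz≈y∙xz e a d' ⟩
      a * (e * d')  ≡⟨ cong (a *_) ed'≡d ⟩
      a * d         ≡⟨ ad≡bc ⟩
      b * c         ≡⟨ cong (b *_) (sym ec'≡c) ⟩
      b * (e * c')  ≡⟨ x∙yz≈y∙xz b e c' ⟩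
      e * (b * c')  ∎)

  -- Removing a non-unit factor from a nonzero d yields a proper divisor:
  -- if d ∣ d' with d = e·d', then d·1 = d·(e·k), so e is a unit.
  nonunit-proper : ∀ e d' {d} → d ≢ 0# → e * d' ≡ d → ¬ IsUnit e → ¬ d ∣ d'
  nonunit-proper e d' {d} d≢0 ed'≡d ¬unit (k , dk≡d') =
    ¬unit (k , sym (*-cancelˡ d d≢0 (begin
      d * 1#        ≡⟨ *-identityʳ d ⟩
      d             ≡⟨ sym ed'≡d ⟩
      e * d'        ≡⟨ cong (e *_) (sym dk≡d') ⟩
      e * (d * k)   ≡⟨ x∙yz≈y∙xz e d k ⟩
      d * (e * k)   ∎)))

  Coprime : Carrier → Carrier → Set
  Coprime c d = ∀ e → e ∣ c → e ∣ d → IsUnit e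

  CommonNonUnit : Carrier → Carrier → Carrier → Set
  CommonNonUnit c d e = e ∣ c × e ∣ d × ¬ IsUnit e

  -- Coprimality is decidable: a common divisor of c and d lies in D d.
  coprime-or-common : ∀ c d → d ≢ 0# → Coprime c d ⊎ ∃ (CommonNonUnit c d)
  coprime-or-common c d d≢0
    with any? (λ e → (e ∣? c) ×-dec (e ∣? d) ×-dec ¬? (unit? e)) (D d d≢0)
  ... | yes found = inj₂ (satisfied found)
  ... | no none   = inj₁ coprime
    where
    coprime : Coprime c d
    coprime e e∣c e∣d with unit? e
    ... | yes unit = unit
    ... | no ¬unit = ⊥-elim (none (lose (D-complete d d≢0 e e∣d) (e∣c , e∣d , ¬unit)))

  Reduced : Carrier → Carrier → Carrier × Carrier → Set
  Reduced a b (c , d) = d ≢ 0# × SameFraction c d a b × Coprime c d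

  module _ (a b : Carrier) (b≢0 : b ≢ 0#) where

    record Candidate : Set where
      field
        num den      : Carrier
        den≢0        : den ≢ 0#
        sameFraction : SameFraction num den a b
        den∣b        : den ∣ b
    open Candidate

    μ : Carrier → ℕ
    μ d = length (filter (_∣? d) (D b b≢0))

    -- Passing to a proper divisor of a divisor of b decreases μ, since d
    -- itself is counted for d but not for d'.
    μ-proper : ∀ {d d'} → d ∣ b → d' ∣ d → ¬ d ∣ d' → μ d' < μ d
    μ-proper {d} {d'} d∣b d'∣d d∤d' =
      FilterCount.filter-strict (_∣? d') (_∣? d) (λ x x∣d' → ∣-trans x∣d' d'∣d)
        (D b b≢0) (D-complete b b≢0 d d∣b) (∣-refl d) d∤d'

    shrink : (p : Candidate) → ∃ (CommonNonUnit (num p) (den p)) →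
             Σ Candidate λ q → μ (den q) < μ (den p)
    shrink p (e , (c' , ec'≡c) , (d' , ed'≡d) , ¬unit) = q , μ-proper (den∣b p) d'∣d d∤d'
      where
      d'∣d : d' ∣ den p
      d'∣d = e , trans (*-comm d' e) ed'≡d
      e≢0 : e ≢ 0#
      e≢0 = factor-≢0 d' e (trans (*-comm d' e) ed'≡d) (den≢0 p)
      d∤d' : ¬ den p ∣ d'
      d∤d' = nonunit-proper e d' (den≢0 p) ed'≡d ¬unit
      q : Candidate
      q = record
        { num = c'
        ; den = d'
        ; den≢0 = factor-≢0 e d' ed'≡d (den≢0 p)
        ; sameFraction = sameFraction-cancel e c' d' e≢0 ec'≡c ed'≡d (sameFraction p)
        ; den∣b = ∣-trans d'∣d (den∣b p)
        }

    reduce : (p : Candidate) → Acc _<_ (μ (den p)) → Σ (Carrier × Carrier) (Reduced a b)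
    reduce p (acc smaller) with coprime-or-common (num p) (den p) (den≢0 p)
    ... | inj₁ coprime = (num p , den p) , den≢0 p , sameFraction p , coprime
    ... | inj₂ common  = reduce q (smaller μq<μp)
      where
      q = proj₁ (shrink p common)
      μq<μp = proj₂ (shrink p common)

    start : Candidate
    start = record
      { num = a ; den = b ; den≢0 = b≢0
      ; sameFraction = *-comm a b ; den∣b = ∣-refl b }

  reducedForm : ∀ a b → Σ (Carrier × Carrier) (λ p → b ≢ 0# → Reduced a b p)
  reducedForm a b with b ≟ 0#
  ... | yes b≡0 = (a , b) , λ b≢0 → ⊥-elim (b≢0 b≡0)
  ... | no b≢0  = proj₁ r , λ _ → proj₂ r
    where
    r = reduce a b b≢0 (start a b b≢0) (<-wellFounded _)

mainTheorem6 : (A : SCFFD) → let open SCFFD A in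
    Σ (Carrier → Carrier → Carrier × Carrier) λ f →
      ∀ a b → b ≢ 0# →
        proj₂ (f a b) ≢ 0#
        × SameFraction (proj₁ (f a b)) (proj₂ (f a b)) a b
        × (∀ e → e ∣ proj₁ (f a b) → e ∣ proj₂ (f a b) → IsUnit e)
mainTheorem6 A = (λ a b → proj₁ (reducedForm a b)) , λ a b b≢0 → proj₂ (reducedForm a b) b≢0
  where open Reduction A
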